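{- Let $n\ge 1$ and let $i,j$ be integers with $0\le i<j\le n$. Then the maximum number $c_{i\leftarrow j}$ of $j$-cells of $\mathbb{C}_n$ that are bounded by an $i$-cell is $$c_{i\leftarrow j}=2^{j-i}\binom{n-i}{j-i}.$$
   Context: A cell of $\mathbb{R}^n$ is a product $e=\prod_{k=1}^n I_k$ where, for each $k$, $I_k$ is either a closed interval $[x_k-\frac12,x_k+\frac12]$ or a singleton $\{x_k\pm\frac12\}$, with $x_k\in\mathbb{Z}$. Its dimension $\dim(e)$ is the number of non-degenerate factors; an $i$-cell is a cell of dimension $i$. $\mathbb{C}_n$ is the set of all cells of $\mathbb{R}^n$. We say $e_1$ bounds $e_2$ (or $e_2$ is bounded by $e_1$), written $e_1<e_2$, if $e_1\subseteq e_2$ and $\dim(e_1)<\dim(e_2)$. $c_{i\leftarrow j}$ denotes the maximum, over $i$-cells $e$ of $\mathbb{C}_n$, of the number of $j$-cells $f$ with $e<f$. -}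

module Defs where

open import Data.Fin.Base using (Fin)
open import Data.Integer.Base using (ℤ)
open import Data.List.Base using (List; length)
open import Data.List.Membership.Propositional using (_∈_)
open import Data.List.Relation.Unary.Unique.Propositional using (Unique)
open import Data.Nat.Base as ℕ using (ℕ)
open import Data.Product.Base using (∃; _×_; _,_; proj₁; proj₂)
open import Data.Rational.Base as ℚ using (ℚ; _<_; _/_; ½; 1ℚ)
open import Data.Rational.Properties as ℚ
  using (_<?_; <-dense; <-trans; <-asym; ≮⇒≥; ≤-<-trans; +-monoʳ-<; +-identityʳ)
open import Data.Sum.Base using (_⊎_; inj₁; inj₂)
open import Data.Vec.Base using (Vec; lookup; count)
open import Function.Bundles using (_⇔_; mk⇔)
open import Level using (0ℓ; _⊔_)
open import Relation.Binary.PropositionalEquality.Core using (_≡_; subst)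
open import Relation.Nullary using (¬_; yes; no)
open import Relation.Unary using (Pred; Decidable; _⊆_; Satisfiable)

record ℝ : Set₁ where
  field
    Lower Upper     : Pred ℚ 0ℓ
    lower-inhabited : Satisfiable Lower
    upper-inhabited : Satisfiable Upper
    lower-rounded   : ∀ q → Lower q ⇔ (∃ λ r → q < r × Lower r)
    upper-rounded   : ∀ q → Upper q ⇔ (∃ λ r → r < q × Upper r)
    disjoint        : ∀ q → ¬ (Lower q × Upper q)
    located         : ∀ q r → q < r → Lower q ⊎ Upper r

open ℝ

infix 4 _≤ᴿ_ _≈ᴿ_

-- Reals are Dedekind cuts; as cuts are located, inclusion of lower cuts is
-- equivalent to reverse inclusion of upper cuts.

_≤ᴿ_ : ℝ → ℝ → Set
x ≤ᴿ y = Lower x ⊆ Lower y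

_≈ᴿ_ : ℝ → ℝ → Set
x ≈ᴿ y = x ≤ᴿ y × y ≤ᴿ x

fromℚ : ℚ → ℝ
fromℚ a = record
  { Lower           = _< a
  ; Upper           = a <_
  ; lower-inhabited = a ℚ.- 1ℚ , below
  ; upper-inhabited = a ℚ.+ 1ℚ , above
  ; lower-rounded   = λ _ → mk⇔ <-dense (λ (_ , q<r , r<a) → <-trans q<r r<a)
  ; upper-rounded   = λ _ → mk⇔
      (λ a<q → let r , a<r , r<q = <-dense a<q in r , r<q , a<r)
      (λ (_ , r<q , a<r) → <-trans a<r r<q)
  ; disjoint        = λ _ (q<a , a<q) → <-asym q<a a<q
  ; located         = split
  }
  where
  below : a ℚ.- 1ℚ < a
  below = subst (a ℚ.- 1ℚ <_) (+-identityʳ a)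
            (+-monoʳ-< a (ℚ.negative⁻¹ (ℚ.- 1ℚ)))

  above : a < a ℚ.+ 1ℚ
  above = subst (_< a ℚ.+ 1ℚ) (+-identityʳ a)
            (+-monoʳ-< a (ℚ.positive⁻¹ 1ℚ))

  split : ∀ q r → q < r → q < a ⊎ a < r
  split q r q<r with q <? a
  ... | yes q<a = inj₁ q<a
  ... | no  q≮a = inj₂ (≤-<-trans (≮⇒≥ q≮a) q<r)

_-½ _+½ : ℤ → ℝ
x -½ = fromℚ (x / 1 ℚ.- ½)
x +½ = fromℚ (x / 1 ℚ.+ ½)

-- interval x stands for [x - ½ , x + ½] and singleton x for { x + ½ }.
-- Since { x - ½ } = { (x - 1) + ½ }, a separate constructor for x - ½ would
-- only duplicate singletons; with this choice distinct codes denote distinct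
-- subsets of ℝ, so propositional equality of codes is equality of cells.

data Factor : Set where
  interval  : ℤ → Factor
  singleton : ℤ → Factor

⟦_⟧ᶠ : Factor → Pred ℝ 0ℓ
⟦ interval  x ⟧ᶠ t = (x -½) ≤ᴿ t × t ≤ᴿ (x +½)
⟦ singleton x ⟧ᶠ t = t ≈ᴿ (x +½)

data NonDegenerate : Pred Factor 0ℓ where
  interval : ∀ x → NonDegenerate (interval x)

nonDegenerate? : Decidable NonDegenerate
nonDegenerate? (interval  x) = yes (interval x)
nonDegenerate? (singleton x) = no λ ()

Cell : ℕ → Set
Cell n = Vec Factor n

⟦_⟧ : ∀ {n} → Cell n → Pred (Fin n → ℝ) 0ℓ
⟦ e ⟧ p = ∀ k → ⟦ lookup e k ⟧ᶠ (p k)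

dim : ∀ {n} → Cell n → ℕ
dim e = count nonDegenerate? e

infix 4 _bounds_

_bounds_ : ∀ {n} → Cell n → Cell n → Set₁
e₁ bounds e₂ = ⟦ e₁ ⟧ ⊆ ⟦ e₂ ⟧ × dim e₁ ℕ.< dim e₂

HasSize : ∀ {a p} {A : Set a} → Pred A p → ℕ → Set (a ⊔ p)
HasSize {A = A} P m =
  ∃ λ (xs : List A) → Unique xs × (∀ x → x ∈ xs ⇔ P x) × length xs ≡ m

BoundedCells : ∀ {n} → Cell n → ℕ → Pred (Cell n) _
BoundedCells e j f = dim f ≡ j × e bounds f

-- c[ n ] i ← j ≔ m states that c_{i←j}, taken in ℝⁿ, exists and equals m:
-- the value m is attained, and every i-cell bounds finitely many j-cells,
-- at most m of them.

c[_]_←_≔_ : ℕ → ℕ → ℕ → ℕ → Set₁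
c[ n ] i ← j ≔ m =
    (∃ λ (e : Cell n) → dim e ≡ i × HasSize (BoundedCells e j) m)
  × (∀ (e : Cell n) → dim e ≡ i → ∃ λ k → HasSize (BoundedCells e j) k × k ℕ.≤ m)

{-# OPTIONS --safe #-}
-- An inclusion of cells is a coordinatewise inclusion of their factors, since factors are inhabited.
-- A non-degenerate factor is contained in no factor but itself, whereas { x + ½ } is contained in itself
-- and in the two intervals centred at x and x + 1. So the j-cells bounded by an i-cell arise by choosing
-- j − i of its n − i degenerate factors and one of two thickenings for each.
module Submission where

open import Data.Empty using (⊥-elim)
open import Data.Fin.Base using (zero; suc)
open import Data.Integer.Base as ℤ using (ℤ; 1ℤ)
import Data.Integer.Properties as ℤ
open import Data.List.Base as List using (List; []; _∷_; _++_; cartesianProductWith; length)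
open import Data.List.Membership.Propositional using (_∈_)
open import Data.List.Membership.Propositional.Properties
  using (∈-map⁺; ∈-map⁻; ∈-++⁺ˡ; ∈-++⁺ʳ; ∈-++⁻; ∈-cartesianProductWith⁺; ∈-cartesianProductWith⁻)
open import Data.List.Properties using (length-map; length-++)
open import Data.List.Relation.Binary.Disjoint.Propositional using (Disjoint)
open import Data.List.Relation.Unary.All using ([]; _∷_)
open import Data.List.Relation.Unary.Any using (here; there)
open import Data.List.Relation.Unary.Unique.Propositional using (Unique; []; _∷_)
import Data.List.Relation.Unary.Unique.Propositional.Properties as Unique
open import Data.Nat.Base using (ℕ; zero; suc; z≤n; s≤s; _≤_; _<_; _+_; _*_; _^_; _∸_)
open import Data.Nat.Combinatorics using (_C_; nCk+nC[k+1]≡[n+1]C[k+1])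
import Data.Nat.Coprimality as Coprimality
import Data.Nat.Properties as ℕ
open import Data.Nat.Tactic.RingSolver using (solve-∀)
open import Data.Product.Base using (∃; _×_; _,_; proj₁; proj₂)
open import Data.Rational.Base as ℚ using (mkℚ; ½; 1ℚ)
import Data.Rational.Properties as ℚ
open import Data.Sum.Base using (inj₁; inj₂)
open import Data.Vec.Base using ([]; _∷_)
import Data.Vec.Functional as Functional
open import Data.Vec.Properties using (∷-injective; ∷-injectiveʳ; count≤n)
open import Function.Base using (id; _∘_)
open import Function.Bundles using (mk⇔)
open import Relation.Binary.PropositionalEquality
  using (_≡_; refl; sym; trans; cong; cong₂; subst; subst₂; module ≡-Reasoning)
open import Relation.Nullary using (¬_; yes; no)
open import Relation.Unary using (_⊆_)

open import Defs

-- Half-integer points and the order on the integers.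

-- The quotient `i / 1` is stuck on a variable `i`; the literal fraction exposes its numerator and
-- denominator to comparison and addition.
i/1≡mkℚ : ∀ i → i ℚ./ 1 ≡ mkℚ i 0 (Coprimality.sym (Coprimality.1-coprimeTo _))
i/1≡mkℚ i = ℚ.↥p/↧p≡p (mkℚ i 0 (Coprimality.sym (Coprimality.1-coprimeTo _)))

/1-mono-≤ : ∀ {i j} → i ℤ.≤ j → i ℚ./ 1 ℚ.≤ j ℚ./ 1
/1-mono-≤ {i} {j} i≤j rewrite i/1≡mkℚ i | i/1≡mkℚ j =
  ℚ.*≤* (ℤ.*-monoʳ-≤-nonNeg 1ℤ i≤j)

/1-cancel-≤ : ∀ {i j} → i ℚ./ 1 ℚ.≤ j ℚ./ 1 → i ℤ.≤ j
/1-cancel-≤ {i} {j} i≤j rewrite i/1≡mkℚ i | i/1≡mkℚ j =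
  ℤ.*-cancelʳ-≤-pos i j 1ℤ (ℚ.drop-*≤* i≤j)

suc/1 : ∀ i → ℤ.suc i ℚ./ 1 ≡ 1ℚ ℚ.+ i ℚ./ 1
-- After the rewrite the sum unfolds to `(1ℤ + i * 1ℤ) / 1`.
suc/1 i rewrite i/1≡mkℚ i = cong (λ k → (1ℤ ℤ.+ k) ℚ./ 1) (sym (ℤ.*-identityʳ i))

fromℚ-mono-≤ : ∀ {p q} → p ℚ.≤ q → fromℚ p ≤ᴿ fromℚ q
fromℚ-mono-≤ p≤q r<p = ℚ.<-≤-trans r<p p≤q

+½-mono-≤ : ∀ {x y} → x ℤ.≤ y → (x +½) ≤ᴿ (y +½)
+½-mono-≤ x≤y = fromℚ-mono-≤ (ℚ.+-monoˡ-≤ ½ (/1-mono-≤ x≤y))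

-- Were `y < x`, the rational `y + ½` would belong to the lower cut of `x +½`, hence to its own
-- lower cut, against irreflexivity.
+½-cancel-≤ : ∀ {x y} → (x +½) ≤ᴿ (y +½) → x ℤ.≤ y
+½-cancel-≤ {x} {y} x≤y =
  ℤ.≮⇒≥ λ y<x → ℚ.<-irrefl refl
    (x≤y (ℚ.+-monoˡ-< ½ (ℚ.≰⇒> (ℤ.<⇒≱ y<x ∘ /1-cancel-≤))))

suc-½ : ∀ x → (ℤ.suc x -½) ≡ (x +½)
suc-½ x = cong fromℚ (begin
  ℤ.suc x ℚ./ 1 ℚ.- ½   ≡⟨ cong (ℚ._- ½) (suc/1 x) ⟩
  1ℚ ℚ.+ x ℚ./ 1 ℚ.- ½  ≡⟨ cong (ℚ._- ½) (ℚ.+-comm 1ℚ (x ℚ./ 1)) ⟩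
  -- Reassociating leaves `1ℚ - ½`, which evaluates to `½`.
  x ℚ./ 1 ℚ.+ 1ℚ ℚ.- ½  ≡⟨ ℚ.+-assoc (x ℚ./ 1) 1ℚ (ℚ.- ½) ⟩
  x ℚ./ 1 ℚ.+ ½         ∎)
  where open ≡-Reasoning

-- With left endpoints in the form `_+½` too, every comparison of endpoints becomes one of integers.
-½≡pred+½ : ∀ x → (x -½) ≡ (ℤ.pred x +½)
-½≡pred+½ x = trans (cong _-½ (sym (ℤ.suc-pred x))) (suc-½ (ℤ.pred x))

+½∈interval⁺ : ∀ {x y} → ℤ.pred y ℤ.≤ x → x ℤ.≤ y → ⟦ interval y ⟧ᶠ (x +½)
+½∈interval⁺ {x} {y} y-1≤x x≤y =
  subst (_≤ᴿ (x +½)) (sym (-½≡pred+½ y)) (+½-mono-≤ y-1≤x) , +½-mono-≤ x≤y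

+½∈interval⁻ : ∀ x y → ⟦ interval y ⟧ᶠ (x +½) → ℤ.pred y ℤ.≤ x × x ℤ.≤ y
+½∈interval⁻ x y (y-½≤x+½ , x+½≤y+½) =
  +½-cancel-≤ (subst (_≤ᴿ (x +½)) (-½≡pred+½ y) y-½≤x+½) , +½-cancel-≤ x+½≤y+½

+½∈singleton⁻ : ∀ x y → ⟦ singleton y ⟧ᶠ (x +½) → x ≡ y
+½∈singleton⁻ x y (x≤y , y≤x) = ℤ.≤-antisym (+½-cancel-≤ x≤y) (+½-cancel-≤ y≤x)

pred≤ : ∀ x → ℤ.pred x ℤ.≤ x
pred≤ x = ℤ.i≤j⇒pred[i]≤j ℤ.≤-refl

pred+½∈interval : ∀ x → ⟦ interval x ⟧ᶠ (ℤ.pred x +½)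
pred+½∈interval x = +½∈interval⁺ ℤ.≤-refl (pred≤ x)

+½∈interval : ∀ x → ⟦ interval x ⟧ᶠ (x +½)
+½∈interval x = +½∈interval⁺ (pred≤ x) ℤ.≤-refl

+½∈interval-suc : ∀ x → ⟦ interval (ℤ.suc x) ⟧ᶠ (x +½)
+½∈interval-suc x = +½∈interval⁺ (ℤ.≤-reflexive (ℤ.pred-suc x)) (ℤ.i≤suc[i] x)

+½∈singleton : ∀ x → ⟦ singleton x ⟧ᶠ (x +½)
+½∈singleton x = id , id

-- Inclusions between single factors.

singleton⊆ : ∀ x a → ⟦ a ⟧ᶠ (x +½) → ⟦ singleton x ⟧ᶠ ⊆ ⟦ a ⟧ᶠ
singleton⊆ x (interval y)  (y-½≤x , x≤y+½) (t≤x , x≤t) = (x≤t ∘ y-½≤x) , (x≤y+½ ∘ t≤x)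
singleton⊆ x (singleton y) (x≤y , y≤x)     (t≤x , x≤t) = (x≤y ∘ t≤x) , (x≤t ∘ y≤x)

thickenings : ℤ → List Factor
thickenings x = interval x ∷ interval (ℤ.suc x) ∷ []

thickenings-⊇ : ∀ {x a} → a ∈ thickenings x → ⟦ singleton x ⟧ᶠ ⊆ ⟦ a ⟧ᶠ
thickenings-⊇ {x} (here refl)         {t} = singleton⊆ x (interval x) (+½∈interval x) {t}
thickenings-⊇ {x} (there (here refl)) {t} = singleton⊆ x (interval (ℤ.suc x)) (+½∈interval-suc x) {t}

-- Test both endpoints: the right one gives `x ≤ y`, the left one `pred y ≤ pred x`.
interval⊆interval : ∀ x y → ⟦ interval x ⟧ᶠ ⊆ ⟦ interval y ⟧ᶠ → x ≡ y
interval⊆interval x y x⊆y = ℤ.≤-antisym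
  (proj₂ (+½∈interval⁻ x y (x⊆y {x +½} (+½∈interval x))))
  (subst₂ ℤ._≤_ (ℤ.suc-pred y) (ℤ.suc-pred x)
    (ℤ.suc-mono (proj₁ (+½∈interval⁻ (ℤ.pred x) y (x⊆y {ℤ.pred x +½} (pred+½∈interval x))))))

-- Both endpoints of the interval would equal `y +½`, though `pred x < x`.
interval⊈singleton : ∀ x y → ¬ (⟦ interval x ⟧ᶠ ⊆ ⟦ singleton y ⟧ᶠ)
interval⊈singleton x y x⊆y = ℤ.<⇒≢ (ℤ.i≤pred[j]⇒i<j {ℤ.pred x} ℤ.≤-refl) (trans
  (+½∈singleton⁻ (ℤ.pred x) y (x⊆y {ℤ.pred x +½} (pred+½∈interval x)))
  (sym (+½∈singleton⁻ x y (x⊆y {x +½} (+½∈interval x)))))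

singleton⊆interval : ∀ x y → ⟦ singleton x ⟧ᶠ ⊆ ⟦ interval y ⟧ᶠ → interval y ∈ thickenings x
-- The bounds `pred y ≤ x ≤ y` leave only `y = x` and `y = suc x`, told apart by whether `x < y`.
singleton⊆interval x y x⊆y with +½∈interval⁻ x y (x⊆y {x +½} (+½∈singleton x)) | x ℤ.<? y
... | _     , x≤y | no  x≮y = here (cong interval (sym (ℤ.≤∧≮⇒≡ x≤y x≮y)))
... | y-1≤x , _   | yes x<y = there (here (cong interval (ℤ.≤-antisym
  (subst (ℤ._≤ ℤ.suc x) (ℤ.suc-pred y) (ℤ.suc-mono y-1≤x)) (ℤ.i<j⇒suc[i]≤j x<y))))

singleton⊆singleton : ∀ x y → ⟦ singleton x ⟧ᶠ ⊆ ⟦ singleton y ⟧ᶠ → x ≡ y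
singleton⊆singleton x y x⊆y = +½∈singleton⁻ x y (x⊆y {x +½} (+½∈singleton x))

-- Inclusion of cells in combinatorial form.

-- A derivation records coordinate by coordinate how `f` arises from `e`; `d` counts the thickened
-- coordinates, hence the gain in dimension.
data Coface : ∀ {n} → Cell n → ℕ → Cell n → Set where
  []      : Coface [] 0 []
  keep    : ∀ {n d} {e f : Cell n} a → Coface e d f → Coface (a ∷ e) d (a ∷ f)
  thicken : ∀ {n d x a} {e f : Cell n} →
            a ∈ thickenings x → Coface e d f → Coface (singleton x ∷ e) (suc d) (a ∷ f)

coface-dim : ∀ {n d} {e f : Cell n} → Coface e d f → dim f ≡ d + dim e
coface-dim []                              = refl
coface-dim {d = d} (keep (interval x) c)   = trans (cong suc (coface-dim c)) (sym (ℕ.+-suc d _))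
coface-dim (keep (singleton x) c)          = coface-dim c
coface-dim (thicken (here refl) c)         = cong suc (coface-dim c)
coface-dim (thicken (there (here refl)) c) = cong suc (coface-dim c)

coface-⊇ : ∀ {n d} {e f : Cell n} → Coface e d f → ⟦ e ⟧ ⊆ ⟦ f ⟧
coface-⊇ (keep a c)    p∈ zero    = p∈ zero
coface-⊇ (keep a c)    p∈ (suc k) = coface-⊇ c (p∈ ∘ suc) k
coface-⊇ (thicken t c) p∈ zero    = thickenings-⊇ t (p∈ zero)
coface-⊇ (thicken t c) p∈ (suc k) = coface-⊇ c (p∈ ∘ suc) k

factor-inhabited : ∀ a → ∃ ⟦ a ⟧ᶠ
factor-inhabited (interval x)  = x +½ , +½∈interval x
factor-inhabited (singleton x) = x +½ , +½∈singleton x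

∷-∈ : ∀ {n a} {e : Cell n} {t p} → ⟦ a ⟧ᶠ t → ⟦ e ⟧ p → ⟦ a ∷ e ⟧ (t Functional.∷ p)
∷-∈ t∈ p∈ zero    = t∈
∷-∈ t∈ p∈ (suc k) = p∈ k

cell-inhabited : ∀ {n} (e : Cell n) → ∃ ⟦ e ⟧
cell-inhabited []      = (λ ()) , λ ()
cell-inhabited (a ∷ e) = _ , ∷-∈ {a = a} {e} (proj₂ (factor-inhabited a)) (proj₂ (cell-inhabited e))

-- Pad `t` with a fixed point of `e` and read off coordinate zero; without such a point the
-- inclusion of products would say nothing about `a`.
head-⊆ : ∀ {n a b} {e f : Cell n} → ⟦ a ∷ e ⟧ ⊆ ⟦ b ∷ f ⟧ → ⟦ a ⟧ᶠ ⊆ ⟦ b ⟧ᶠ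
head-⊆ {a = a} {e = e} ae⊆bf t∈ = ae⊆bf (∷-∈ {a = a} {e} t∈ (proj₂ (cell-inhabited e))) zero

tail-⊆ : ∀ {n a b} {e f : Cell n} → ⟦ a ∷ e ⟧ ⊆ ⟦ b ∷ f ⟧ → ⟦ e ⟧ ⊆ ⟦ f ⟧
tail-⊆ {a = a} {e = e} ae⊆bf p∈ k = ae⊆bf (∷-∈ {a = a} {e} (proj₂ (factor-inhabited a)) p∈) (suc k)

-- The index `d′` is existential because `keep` preserves `d` while `thicken` raises it; comparing
-- dimensions identifies it later.
∷-coface : ∀ {n d} {e f : Cell n} a b → ⟦ a ⟧ᶠ ⊆ ⟦ b ⟧ᶠ → Coface e d f → ∃ λ d′ → Coface (a ∷ e) d′ (b ∷ f)
∷-coface (interval x)  (singleton y) a⊆b c = ⊥-elim (interval⊈singleton x y (λ {t} → a⊆b {t}))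
∷-coface (singleton x) (interval y)  a⊆b c = _ , thicken (singleton⊆interval x y (λ {t} → a⊆b {t})) c
∷-coface (interval x)  (interval y)  a⊆b c with refl ← interval⊆interval x y (λ {t} → a⊆b {t}) = _ , keep _ c
∷-coface (singleton x) (singleton y) a⊆b c with refl ← singleton⊆singleton x y (λ {t} → a⊆b {t}) = _ , keep _ c

⊆⇒coface : ∀ {n} (e f : Cell n) → ⟦ e ⟧ ⊆ ⟦ f ⟧ → ∃ λ d → Coface e d f
⊆⇒coface []      []      _     = _ , []
⊆⇒coface (a ∷ e) (b ∷ f) ae⊆bf =
  ∷-coface a b (head-⊆ {a = a} {b} {e} {f} ae⊆bf)
    (proj₂ (⊆⇒coface e f (tail-⊆ {a = a} {b} {e} {f} ae⊆bf)))

-- Enumerating and counting cofaces.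

cofaces : ∀ {n} → Cell n → ℕ → List (Cell n)
cofaces []                zero    = [] ∷ []
cofaces []                (suc d) = []
cofaces (interval x ∷ e)  d       = List.map (interval x ∷_) (cofaces e d)
cofaces (singleton x ∷ e) zero    = List.map (singleton x ∷_) (cofaces e zero)
-- Either the head stays degenerate and all `suc d` thickenings fall on the tail, or one is spent
-- here in two ways. This split becomes Pascal's rule.
cofaces (singleton x ∷ e) (suc d) =
  List.map (singleton x ∷_) (cofaces e (suc d)) ++
  cartesianProductWith _∷_ (thickenings x) (cofaces e d)

∈-cofaces⁺ : ∀ {n d} {e f : Cell n} → Coface e d f → f ∈ cofaces e d
∈-cofaces⁺ []                                 = here refl
∈-cofaces⁺ (keep (interval x) c)              = ∈-map⁺ _ (∈-cofaces⁺ c)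
∈-cofaces⁺ {d = zero}  (keep (singleton x) c) = ∈-map⁺ _ (∈-cofaces⁺ c)
∈-cofaces⁺ {d = suc d} (keep (singleton x) c) = ∈-++⁺ˡ (∈-map⁺ _ (∈-cofaces⁺ c))
∈-cofaces⁺ {d = suc d} {singleton x ∷ e} (thicken t c) =
  ∈-++⁺ʳ (List.map (singleton x ∷_) (cofaces e (suc d))) (∈-cartesianProductWith⁺ _∷_ t (∈-cofaces⁺ c))

∈-cofaces⁻ : ∀ {n} (e : Cell n) d {f} → f ∈ cofaces e d → Coface e d f
∈-cofaces⁻ [] zero (here refl) = []
∈-cofaces⁻ (interval x ∷ e) d f∈ with _ , g∈ , refl ← ∈-map⁻ _ f∈ = keep _ (∈-cofaces⁻ e d g∈)
∈-cofaces⁻ (singleton x ∷ e) zero f∈ with _ , g∈ , refl ← ∈-map⁻ _ f∈ = keep _ (∈-cofaces⁻ e zero g∈)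
∈-cofaces⁻ (singleton x ∷ e) (suc d) f∈ with ∈-++⁻ (List.map _ (cofaces e (suc d))) f∈
... | inj₁ f∈₁ with _ , g∈ , refl ← ∈-map⁻ _ f∈₁ = keep _ (∈-cofaces⁻ e (suc d) g∈)
... | inj₂ f∈₂ with _ , _ , t , g∈ , refl ← ∈-cartesianProductWith⁻ _∷_ (thickenings x) (cofaces e d) f∈₂ =
  thicken t (∈-cofaces⁻ e d g∈)

interval-injective : ∀ {x y} → Factor.interval x ≡ Factor.interval y → x ≡ y
interval-injective refl = refl

thickenings-unique : ∀ x → Unique (thickenings x)
thickenings-unique x = ((ℤ.i≢suc[i] ∘ interval-injective) ∷ []) ∷ [] ∷ []

cofaces-unique : ∀ {n} (e : Cell n) d → Unique (cofaces e d)
cofaces-unique []                zero    = [] ∷ []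
cofaces-unique []                (suc d) = []
cofaces-unique (interval x ∷ e)  d       = Unique.map⁺ ∷-injectiveʳ (cofaces-unique e d)
cofaces-unique (singleton x ∷ e) zero    = Unique.map⁺ ∷-injectiveʳ (cofaces-unique e zero)
cofaces-unique (singleton x ∷ e) (suc d) = Unique.++⁺
  (Unique.map⁺ ∷-injectiveʳ (cofaces-unique e (suc d)))
  (Unique.cartesianProductWith⁺ _∷_ ∷-injective (thickenings-unique x) (cofaces-unique e d))
  disjoint
  where
  disjoint : Disjoint (List.map (singleton x ∷_) (cofaces e (suc d)))
                      (cartesianProductWith _∷_ (thickenings x) (cofaces e d))
  -- A common cell would have both a singleton and an interval as its head.
  disjoint (f∈₁ , f∈₂)
    with _ , _ , refl ← ∈-map⁻ (singleton x ∷_) f∈₁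
    with ∈-cartesianProductWith⁻ _∷_ (thickenings x) (cofaces e d) f∈₂
  ... | _ , _ , here () , _ , refl
  ... | _ , _ , there (here ()) , _ , refl

length-cartesianProductWith : ∀ {a b c} {A : Set a} {B : Set b} {C : Set c} (f : A → B → C) xs ys →
  length (cartesianProductWith f xs ys) ≡ length xs * length ys
length-cartesianProductWith f []       ys = refl
length-cartesianProductWith f (x ∷ xs) ys = trans (length-++ (List.map (f x) ys))
  (cong₂ _+_ (length-map (f x) ys) (length-cartesianProductWith f xs ys))

cofaces-length : ∀ {n} (e : Cell n) d → length (cofaces e d) ≡ 2 ^ d * ((n ∸ dim e) C d)
cofaces-length []                zero    = refl
cofaces-length []                (suc d) = sym (ℕ.*-zeroʳ (2 ^ suc d))
-- An interval head raises length and dimension together, so their difference is unchanged.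
cofaces-length (interval x ∷ e)  d       = trans (length-map _ (cofaces e d)) (cofaces-length e d)
-- Since `k C 0` is `1` for every `k`, one more degenerate factor leaves the count alone.
cofaces-length (singleton x ∷ e) zero    = trans (length-map _ (cofaces e zero)) (cofaces-length e zero)
cofaces-length {suc n} (singleton x ∷ e) (suc d) = begin
  length (List.map (singleton x ∷_) same ++ cartesianProductWith _∷_ (thickenings x) thicker)
    ≡⟨ length-++ (List.map (singleton x ∷_) same) ⟩
  length (List.map (singleton x ∷_) same) + length (cartesianProductWith _∷_ (thickenings x) thicker)
    ≡⟨ cong₂ _+_ (length-map _ same) (length-cartesianProductWith _∷_ (thickenings x) thicker) ⟩
  length same + 2 * length thicker
    ≡⟨ cong₂ (λ k l → k + 2 * l) (cofaces-length e (suc d)) (cofaces-length e d) ⟩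
  2 ^ suc d * (m C suc d) + 2 * (2 ^ d * (m C d))
    -- The two thickenings supply the missing factor of `2 ^ suc d`, leaving the two terms of
    -- Pascal's rule.
    ≡⟨ rearrange (2 ^ d) (m C suc d) (m C d) ⟩
  2 ^ suc d * (m C d + m C suc d)
    ≡⟨ cong (2 ^ suc d *_) (nCk+nC[k+1]≡[n+1]C[k+1] m d) ⟩
  2 ^ suc d * (suc m C suc d)
    -- Truncated subtraction commutes with `suc` here because `dim e ≤ n`.
    ≡⟨ cong (λ k → 2 ^ suc d * (k C suc d)) (ℕ.+-∸-assoc 1 (count≤n nonDegenerate? e)) ⟨
  2 ^ suc d * ((suc n ∸ dim e) C suc d)
    ∎
  where
  open ≡-Reasoning
  m       = n ∸ dim e
  same    = cofaces e (suc d)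
  thicker = cofaces e d

  rearrange : ∀ p a b → 2 * p * a + 2 * (p * b) ≡ 2 * p * (b + a)
  rearrange = solve-∀

-- The maximum.

cellOfDim : ∀ {n i} → i ≤ n → ∃ λ (e : Cell n) → dim e ≡ i
cellOfDim {zero}  z≤n       = [] , refl
cellOfDim {suc n} z≤n       = let e , eq = cellOfDim {n} z≤n in singleton ℤ.0ℤ ∷ e , eq
cellOfDim         (s≤s i≤n) = let e , eq = cellOfDim i≤n in interval ℤ.0ℤ ∷ e , cong suc eq

-- The count depends on `e` only through its dimension, so the maximum is a value common to all
-- cells of that dimension.
boundedCells-size : ∀ {n j} (e : Cell n) → dim e < j →
  HasSize (BoundedCells e j) (2 ^ (j ∸ dim e) * ((n ∸ dim e) C (j ∸ dim e)))
boundedCells-size {j = j} e i<j =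
  cofaces e d , cofaces-unique e d , (λ f → mk⇔ sound complete) , cofaces-length e d
  where
  d = j ∸ dim e

  d+i≡j : d + dim e ≡ j
  d+i≡j = ℕ.m∸n+n≡m (ℕ.<⇒≤ i<j)

  sound : ∀ {f} → f ∈ cofaces e d → BoundedCells e j f
  sound f∈ =
    let c = ∈-cofaces⁻ e d f∈
        dim-f≡j = trans (coface-dim c) d+i≡j
    in dim-f≡j , coface-⊇ c , subst (dim e <_) (sym dim-f≡j) i<j

  complete : ∀ {f} → BoundedCells e j f → f ∈ cofaces e d
  complete {f} (dim-f≡j , e⊆f , _) with d′ , c ← ⊆⇒coface e f e⊆f =
    -- Both `d′ + dim e` and `d + dim e` equal `j`, so `d′` is `d`.
    subst (λ k → f ∈ cofaces e k)
      (ℕ.+-cancelʳ-≡ (dim e) d′ d (trans (sym (coface-dim c)) (trans dim-f≡j (sym d+i≡j))))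
      (∈-cofaces⁺ c)

proposition10 : ∀ (n i j : ℕ) → 1 ≤ n → i < j → j ≤ n →
    c[ n ] i ← j ≔ (2 ^ (j ∸ i) * ((n ∸ i) C (j ∸ i)))
proposition10 n i j _ i<j j≤n
  with e , refl ← cellOfDim (ℕ.≤-trans (ℕ.<⇒≤ i<j) j≤n)
  = (e , refl , boundedCells-size e i<j)
  -- Any other `i`-cell has exactly the same count, so the upper bound holds with equality.
  , λ e′ eq → _ , subst (λ k → HasSize (BoundedCells e′ j) (2 ^ (j ∸ k) * ((n ∸ k) C (j ∸ k))))
                    eq (boundedCells-size e′ (subst (_< j) (sym eq) i<j)) , ℕ.≤-refl
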